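{- For every $n\ge 1$ and every signature $\sigma$ of the fan graph $F_n = K_1\vee P_n$, $l(F_n,\sigma) = p^-_{\triangle}(F_n,\sigma)$.
   Context: All graphs are finite, simple and undirected. A signed graph $\Sigma=(G,\sigma)$ is a graph $G$ with a signature $\sigma:E(G)\to\{+1,-1\}$. The sign of a cycle is the product of the signs of its edges; $\Sigma$ is balanced if all its cycles are positive. The frustration index $l(\Sigma)$ is the minimum number of edges whose deletion makes $\Sigma$ balanced. $p^-_{\triangle}(\Sigma)$ is the maximum number of pairwise edge-disjoint negative triangles in $\Sigma$. $P_n$ is the path on $n$ vertices and $\vee$ denotes the join of vertex-disjoint graphs. -}

module Defs where

open import Data.Fin.Base using (Fin; toℕ)
open import Data.Fin.Properties as Fin using (+↔⊎; inj⇒≟)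
open import Data.List.Base using (List; []; _∷_; [_]; length; map; foldr)
open import Data.List.Relation.Unary.All using (All)
open import Data.List.Relation.Unary.AllPairs using (AllPairs)
open import Data.List.Relation.Unary.Any using (any?)
import Data.List.Membership.Setoid as Membership
open import Data.List.Membership.Setoid.Properties using (∈-resp-≈)
open import Data.List.Relation.Binary.Disjoint.Setoid using (Disjoint)
open import Data.List.Relation.Unary.Unique.Propositional using (Unique)
open import Data.List.Relation.Unary.Unique.Setoid using () renaming (Unique to UniqueS)
open import Data.Nat.Base as ℕ using (ℕ; suc; _≤_; _≥_)
import Data.Nat.Properties as ℕ
open import Data.Product.Base using (_×_; _,_; Σ-syntax; ∃-syntax; proj₁)
open import Data.Sign.Base as Sign using (Sign)
open import Data.Sum.Base as Sum using (_⊎_; inj₁; inj₂)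
open import Data.Sum.Function.Propositional using (_⊎-↔_)
open import Data.Unit.Base using (⊤; tt)
open import Function.Bundles using (_↔_; Func; _⟶ₛ_; _⟨$⟩_)
open import Function.Construct.Composition using (_↔-∘_)
open import Function.Construct.Identity using (↔-id)
open import Function.Construct.Symmetry using (↔-sym)
open import Function.Properties.Inverse using (↔⇒↣)
open import Level using (0ℓ)
open import Relation.Binary.Bundles using (Setoid)
open import Relation.Binary.Construct.Closure.ReflexiveTransitive using (Star; ε; _◅_)
open import Relation.Binary.Core using (Rel)
open import Relation.Binary.Definitions
  using (Decidable; DecidableEquality; Irreflexive; Symmetric)
open import Relation.Binary.PropositionalEquality
  using (_≡_; _≢_; refl; sym; trans; setoid; ≢-sym)
open import Relation.Nullary.Decidable using (yes; no; ¬?; _×-dec_; _⊎-dec_)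

record Graph : Set₁ where
  infix 4 _~_ _~?_
  field
    Vertex : Set
    order  : ℕ
    finite : Vertex ↔ Fin order
    _~_    : Rel Vertex 0ℓ
    ~-sym  : Symmetric _~_
    ~-irr  : Irreflexive _≡_ _~_
    _~?_   : Decidable _~_

  infix 4 _≟_
  _≟_ : DecidableEquality Vertex
  _≟_ = inj⇒≟ (↔⇒↣ finite)

K : ℕ → Graph
K n = record
  { Vertex = Fin n
  ; order  = n
  ; finite = ↔-id (Fin n)
  ; _~_    = _≢_
  ; ~-sym  = ≢-sym
  ; ~-irr  = λ i≡j i≢j → i≢j i≡j
  ; _~?_   = λ i j → ¬? (i Fin.≟ j)
  }

P : ℕ → Graph
P n = record
  { Vertex = Fin n
  ; order  = n
  ; finite = ↔-id (Fin n)
  ; _~_    = λ i j → suc (toℕ i) ≡ toℕ j ⊎ suc (toℕ j) ≡ toℕ i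
  ; ~-sym  = Sum.swap
  ; ~-irr  = λ { refl (inj₁ p) → ℕ.1+n≢n p ; refl (inj₂ p) → ℕ.1+n≢n p }
  ; _~?_   = λ i j → (suc (toℕ i) ℕ.≟ toℕ j) ⊎-dec (suc (toℕ j) ℕ.≟ toℕ i)
  }

infixr 6 _∨_
_∨_ : Graph → Graph → Graph
G ∨ H = record
  { Vertex = G.Vertex ⊎ H.Vertex
  ; order  = G.order ℕ.+ H.order
  ; finite = ↔-sym (+↔⊎ {G.order} {H.order}) ↔-∘ (G.finite ⊎-↔ H.finite)
  ; _~_    = Adj
  ; ~-sym  = λ {x} {y} → Adj-sym x y
  ; ~-irr  = Adj-irr
  ; _~?_   = Adj?
  }
  where
  module G = Graph G
  module H = Graph H

  Adj : Rel (G.Vertex ⊎ H.Vertex) 0ℓ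
  Adj (inj₁ u) (inj₁ v) = u G.~ v
  Adj (inj₁ _) (inj₂ _) = ⊤
  Adj (inj₂ _) (inj₁ _) = ⊤
  Adj (inj₂ u) (inj₂ v) = u H.~ v

  Adj-sym : ∀ x y → Adj x y → Adj y x
  Adj-sym (inj₁ _) (inj₁ _) = G.~-sym
  Adj-sym (inj₁ _) (inj₂ _) = λ _ → tt
  Adj-sym (inj₂ _) (inj₁ _) = λ _ → tt
  Adj-sym (inj₂ _) (inj₂ _) = H.~-sym

  Adj-irr : Irreflexive _≡_ Adj
  Adj-irr {inj₁ _} refl = G.~-irr refl
  Adj-irr {inj₂ _} refl = H.~-irr refl

  Adj? : Decidable Adj
  Adj? (inj₁ u) (inj₁ v) = u G.~? v
  Adj? (inj₁ _) (inj₂ _) = yes tt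
  Adj? (inj₂ _) (inj₁ _) = yes tt
  Adj? (inj₂ u) (inj₂ v) = u H.~? v

F : ℕ → Graph
F n = K 1 ∨ P n

record Edge (G : Graph) : Set where
  constructor edge
  open Graph G
  field
    {src tgt} : Vertex
    adjacent  : src ~ tgt

-- Edges are undirected, and there is at most one between two vertices.
E : Graph → Setoid 0ℓ 0ℓ
E G = record
  { Carrier       = Edge G
  ; _≈_           = λ e f → (src e ≡ src f × tgt e ≡ tgt f)
                          ⊎ (src e ≡ tgt f × tgt e ≡ src f)
  ; isEquivalence = record
    { refl  = inj₁ (refl , refl)
    ; sym   = λ { (inj₁ (p , q)) → inj₁ (sym p , sym q)
                ; (inj₂ (p , q)) → inj₂ (sym q , sym p) }
    ; trans = λ { (inj₁ (p , q)) (inj₁ (r , s)) → inj₁ (trans p r , trans q s)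
                ; (inj₁ (p , q)) (inj₂ (r , s)) → inj₂ (trans p r , trans q s)
                ; (inj₂ (p , q)) (inj₁ (r , s)) → inj₂ (trans p s , trans q r)
                ; (inj₂ (p , q)) (inj₂ (r , s)) → inj₁ (trans p s , trans q r) }
    }
  }
  where open Edge

Signature : Graph → Set
Signature G = E G ⟶ₛ setoid Sign

module _ {G : Graph} where
  open Graph G

  walkEdges : ∀ {u v} → Star _~_ u v → List (Edge G)
  walkEdges ε       = []
  walkEdges (a ◅ w) = edge a ∷ walkEdges w

  walkVertices : ∀ {u v} → Star _~_ u v → List Vertex
  walkVertices {u} ε       = [ u ]
  walkVertices {u} (_ ◅ w) = u ∷ walkVertices w

-- A path on at least three vertices, together with an edge joining its ends.
record Cycle (G : Graph) : Set where
  open Graph G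
  field
    {start end} : Vertex
    path        : Star _~_ start end
    closing     : end ~ start
    distinct    : Unique (walkVertices {G} path)
    long        : length (walkVertices {G} path) ≥ 3

  edges : List (Edge G)
  edges = edge closing ∷ walkEdges path

open Cycle using (edges)

module _ {G : Graph} where
  open Graph G
  open Setoid (E G) using (_≈_)
  open Membership (E G) using (_∈_)

  infix 4 _≈?_ _∈?_
  _≈?_ : Decidable _≈_
  edge {a} {b} _ ≈? edge {c} {d} _ =
    (a ≟ c ×-dec b ≟ d) ⊎-dec (a ≟ d ×-dec b ≟ c)

  _∈?_ : Decidable _∈_
  e ∈? D = any? (e ≈?_) D

infixl 5 _∖_
_∖_ : (G : Graph) → List (Edge G) → Graph
G ∖ D = record
  { Vertex = Vertex
  ; order  = order
  ; finite = finite
  ; _~_    = λ u v → Σ[ a ∈ u ~ v ] edge a ∉ D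
  ; ~-sym  = λ (a , a∉D) → ~-sym a , λ b∈D →
      a∉D (∈-resp-≈ (E G) {D} {edge (~-sym a)} {edge a} (inj₂ (refl , refl)) b∈D)
  ; ~-irr  = λ u≡v (a , _) → ~-irr u≡v a
  ; _~?_   = remains?
  }
  where
  open Graph G
  open Membership (E G) using (_∉_)

  remains? : Decidable (λ u v → Σ[ a ∈ u ~ v ] edge a ∉ D)
  remains? u v with u ~? v
  ... | no ¬a = no λ (a , _) → ¬a a
  ... | yes a with _∈?_ {G} (edge a) D
  ...   | no a∉D  = yes (a , a∉D)
  ...   | yes a∈D = no λ (b , b∉D) →
            b∉D (∈-resp-≈ (E G) {D} {edge a} {edge b} (inj₁ (refl , refl)) a∈D)

restrict : {G : Graph} → Signature G → (D : List (Edge G)) → Signature (G ∖ D)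
restrict σ D = record
  { to   = λ e → σ ⟨$⟩ edge (proj₁ (Edge.adjacent e))
  ; cong = Func.cong σ
  }

module _ {G : Graph} (σ : Signature G) where

  cycleSign : Cycle G → Sign
  cycleSign C = foldr Sign._*_ Sign.+ (map (σ ⟨$⟩_) (edges C))

  Balanced : Set
  Balanced = ∀ C → cycleSign C ≡ Sign.+

  NegativeTriangle : Cycle G → Set
  NegativeTriangle C = length (edges C) ≡ 3 × cycleSign C ≡ Sign.-

EdgeDisjoint : {G : Graph} → Rel (Cycle G) 0ℓ
EdgeDisjoint {G} C C′ = Disjoint (E G) (edges C) (edges C′)

module _ (G : Graph) (σ : Signature G) where

  BalancingSetOfSize : ℕ → Set
  BalancingSetOfSize k =
    ∃[ D ] UniqueS (E G) D × length D ≡ k × Balanced (restrict σ D)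

  NegativeTrianglePackingOfSize : ℕ → Set
  NegativeTrianglePackingOfSize k =
    ∃[ 𝒯 ] All (NegativeTriangle σ) 𝒯 × AllPairs EdgeDisjoint 𝒯 × length 𝒯 ≡ k

  IsFrustrationIndex : ℕ → Set
  IsFrustrationIndex k =
    BalancingSetOfSize k × (∀ {j} → BalancingSetOfSize j → k ≤ j)

  IsNegativeTrianglePackingNumber : ℕ → Set
  IsNegativeTrianglePackingNumber k =
    NegativeTrianglePackingOfSize k × (∀ {j} → NegativeTrianglePackingOfSize j → j ≤ k)

-- Every balancing set meets each negative triangle, so disjoint triangles give a
-- lower bound. Conversely, an edge set is balancing as soon as some
-- switching function θ satisfies σ(uv) = θ(u)θ(v) on all remaining edges.
-- Such a set is found by scanning the triangles T₀, T₁, … of the fan from left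
-- to right: at a negative Tᵢ, pack Tᵢ, delete the spoke shared with Tᵢ₊₁ if Tᵢ₊₁
-- is negative as well and the rim edge of Tᵢ otherwise, and continue at Tᵢ₊₂.
-- Each deletion is matched by a packed triangle, and packed triangles are never
-- consecutive, hence edge-disjoint.
module Submission where

open import Defs
open import Data.Fin.Base using (Fin; zero; suc; toℕ; inject₁)
open import Data.Fin.Properties using (toℕ-inject₁; toℕ-injective)
open import Data.List.Base using (List; []; _∷_; [_]; length; map; foldr; filter; deduplicate)
open import Data.List.Properties using (length-map; filter-notAll; length-deduplicate)
import Data.List.Membership.Propositional as Propositional
open import Data.List.Membership.Propositional.Properties using (∈-map⁺)
import Data.List.Membership.Setoid as Membership
open import Data.List.Membership.Setoid.Properties
  using (∈-resp-≈; ∈-filter⁺; ∈-deduplicate⁺)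
open import Data.List.Relation.Unary.All as All using (All; []; _∷_)
open import Data.List.Relation.Unary.All.Properties as All using (¬Any⇒All¬)
open import Data.List.Relation.Unary.AllPairs as AllPairs using (AllPairs; []; _∷_)
import Data.List.Relation.Unary.AllPairs.Properties as AllPairs
open import Data.List.Relation.Unary.Any as Any using (Any; here; there; any?)
open import Data.List.Relation.Unary.Unique.DecSetoid.Properties using (deduplicate-!)
open import Data.Nat.Base as ℕ using (ℕ; zero; suc; _≤_; _<_; _≥_; _⊔_; z≤n; s≤s)
import Data.Nat.Properties as ℕ
open import Data.Product.Base using (_×_; _,_; ∃-syntax; proj₁; proj₂)
open import Data.Sign.Base using (Sign; +; -; _*_)
open import Data.Sign.Properties
  using (*-assoc; *-comm; *-identityʳ; s*s≡+; *-commutativeSemigroup)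
open import Algebra.Properties.CommutativeSemigroup *-commutativeSemigroup
  using (interchange)
open import Data.Sum.Base as Sum using (_⊎_; inj₁; inj₂; [_,_]′)
open import Data.Unit.Base using (tt)
open import Data.Vec.Functional using () renaming (_∷_ to _◂_)
open import Function.Base using (id; _∘_; _∘′_)
open import Function.Bundles using (Func; _⟨$⟩_)
open import Level using (0ℓ)
open import Relation.Binary.Bundles using (Setoid; DecSetoid)
open import Relation.Binary.Construct.Closure.ReflexiveTransitive using (Star; ε; _◅_)
open import Relation.Binary.PropositionalEquality
  using (_≡_; _≢_; refl; sym; trans; cong; cong₂; subst; module ≡-Reasoning)
open import Relation.Binary.Properties.Setoid using (respʳ-flip)
open import Relation.Nullary.Decidable using (yes; no; ¬?)
open import Relation.Nullary.Negation using (contradiction)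

-- Weak duality and switching functions in an arbitrary signed graph

module _ {G : Graph} where
  open Graph G
  open Cycle
  open Edge
  open Setoid (E G) using (_≈_) renaming (sym to ≈-sym; trans to ≈-trans)
  open Membership (E G) using (_∈_; _∉_; find; lose)

  E-decSetoid : DecSetoid 0ℓ 0ℓ
  E-decSetoid = record
    { Carrier = Edge G
    ; _≈_ = _≈_
    ; isDecEquivalence = record
      { isEquivalence = Setoid.isEquivalence (E G)
      ; _≟_ = _≈?_ {G}
      }
    }

  Meets : List (Edge G) → Cycle G → Set
  Meets D C = Any (_∈ D) (edges C)

  -- Induction on the packing: some edge `e` of the first cycle lies in `D`. Dropping `e` from `D`
  -- shortens it strictly, and the remaining cycles still meet what is left.
  packing≤transversal : ∀ {𝒯 : List (Cycle G)} {D} →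
    AllPairs EdgeDisjoint 𝒯 → All (Meets D) 𝒯 → length 𝒯 ≤ length D
  packing≤transversal [] [] = z≤n
  packing≤transversal {C ∷ 𝒯} {D} (C#𝒯 ∷ 𝒯#) (meets ∷ 𝒯-meets) =
    ℕ.<-≤-trans
      (s≤s (packing≤transversal 𝒯#
        (All.zipWith {P = EdgeDisjoint C} {Q = Meets D}
          (λ {C′} p → survives {C′} (λ {f} → proj₁ p {f}) (proj₂ p)) (C#𝒯 , 𝒯-meets))))
      (filter-notAll avoids? D (Any.map (λ e≈f e≉f → e≉f e≈f) e∈D))
    where
    e   = proj₁ (find meets)
    e∈C = proj₁ (proj₂ (find meets))
    e∈D = proj₂ (proj₂ (find meets))

    avoids? = λ f → ¬? (_≈?_ {G} e f)

    -- The edge where `C′` meets `D` is not `e`, since otherwise `e` would lie on both `C` and `C′`.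
    survives : ∀ {C′} → EdgeDisjoint C C′ → Meets D C′ → Meets (filter avoids? D) C′
    survives {C′} C#C′ meets′ with f , f∈C′ , f∈D ← find meets′ =
      lose {P = _∈ filter avoids? D} (λ {g} {h} → ∈-resp-≈ (E G) {x = g} {h}) {f} f∈C′
        (∈-filter⁺ (E G) avoids?
          (λ {g} {h} g≈h e≉g e≈h → e≉g (≈-trans {e} {h} {g} e≈h (≈-sym {g} {h} g≈h)))
          {f} f∈D
          (λ e≈f → C#C′ {e} (e∈C , ∈-resp-≈ (E G) {x = f} {e} (≈-sym {e} {f} e≈f) f∈C′)))

  module _ (σ : Signature G) where

    module _ {D : List (Edge G)} where

      liftWalk : ∀ {u v} (w : Star _~_ u v) → All (_∉ D) (walkEdges {G} w) →
                 Star (Graph._~_ (G ∖ D)) u v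
      liftWalk ε       []       = ε
      liftWalk (a ◅ w) (p ∷ ps) = (a , p) ◅ liftWalk w ps

      liftWalk-vertices : ∀ {u v} (w : Star _~_ u v) ps →
        walkVertices {G ∖ D} (liftWalk w ps) ≡ walkVertices {G} w
      liftWalk-vertices ε           []       = refl
      liftWalk-vertices {u} (a ◅ w) (p ∷ ps) = cong (u ∷_) (liftWalk-vertices w ps)

      liftWalk-signs : ∀ {u v} (w : Star _~_ u v) ps →
        map (restrict σ D ⟨$⟩_) (walkEdges {G ∖ D} (liftWalk w ps)) ≡
        map (σ ⟨$⟩_) (walkEdges {G} w)
      liftWalk-signs ε       []       = refl
      liftWalk-signs (a ◅ w) (p ∷ ps) = cong (_ ∷_) (liftWalk-signs w ps)

      -- A cycle avoiding `D` lifts to `G ∖ D` with the same edge signs, where balance makes it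
      -- positive.
      balanced⇒meets-negative : Balanced (restrict σ D) →
        ∀ C → cycleSign σ C ≡ - → Meets D C
      balanced⇒meets-negative balanced C C- with any? (λ e → _∈?_ {G} e D) (edges C)
      ... | yes meets = meets
      ... | no ¬meets with c ∷ ps ← ¬Any⇒All¬ _ ¬meets = contradiction (begin
          +                             ≡⟨ sym (balanced C′) ⟩
          cycleSign (restrict σ D) C′   ≡⟨ cong (λ ss → (σ ⟨$⟩ edge (closing C)) * foldr _*_ + ss)
                                                (liftWalk-signs (path C) ps) ⟩
          cycleSign σ C                 ≡⟨ C- ⟩
          -                             ∎) λ ()
        where
        open ≡-Reasoning
        C′ : Cycle (G ∖ D)
        C′ = record
          { path     = liftWalk (path C) ps
          ; closing  = closing C , c
          ; distinct = subst (AllPairs _≢_) (sym (liftWalk-vertices (path C) ps)) (distinct C)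
          ; long     = subst (λ vs → length vs ≥ 3) (sym (liftWalk-vertices (path C) ps)) (long C)
          }

    weak-duality : ∀ {j k} → NegativeTrianglePackingOfSize G σ j →
                   BalancingSetOfSize G σ k → j ≤ k
    weak-duality (_ , negative , disjoint , refl) (_ , _ , refl , balanced) =
      packing≤transversal disjoint
        (All.map (λ {C} (_ , C-) → balanced⇒meets-negative balanced C C-) negative)

    -- Around a cycle every vertex contributes its `θ` twice, so all factors cancel.
    potential⇒balanced : (θ : Vertex → Sign) →
      (∀ e → σ ⟨$⟩ e ≡ θ (src e) * θ (tgt e)) → Balanced σ
    potential⇒balanced θ σ≡θθ C = begin
      (σ ⟨$⟩ edge (closing C)) * walkSign (path C) ≡⟨ cong₂ _*_ (σ≡θθ _) (telescope (path C)) ⟩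
      (θ v * θ u) * (θ u * θ v)                    ≡⟨ cancel-middle (θ v) (θ u) (θ v) ⟩
      θ v * θ v                                    ≡⟨ s*s≡+ (θ v) ⟩
      +                                            ∎
      where
      open ≡-Reasoning
      u = start C
      v = end C

      walkSign : ∀ {x y} → Star _~_ x y → Sign
      walkSign w = foldr _*_ + (map (σ ⟨$⟩_) (walkEdges {G} w))

      cancel-middle : ∀ a b c → (a * b) * (b * c) ≡ a * c
      cancel-middle a b c = begin
        (a * b) * (b * c) ≡⟨ *-assoc a b (b * c) ⟩
        a * (b * (b * c)) ≡⟨ cong (a *_) (*-assoc b b c) ⟨
        a * ((b * b) * c) ≡⟨ cong (λ s → a * (s * c)) (s*s≡+ b) ⟩
        a * c             ∎

      telescope : ∀ {x y} (w : Star _~_ x y) → walkSign w ≡ θ x * θ y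
      telescope {x} ε                = sym (s*s≡+ (θ x))
      telescope {x} {y} (_◅_ {j = z} a w) =
        trans (cong₂ _*_ (σ≡θθ (edge a)) (telescope w)) (cancel-middle (θ x) (θ z) (θ y))

-- A certificate for equality in weak duality

module _ {G : Graph} where
  open Graph G using (Vertex)
  open Edge
  open Setoid (E G) using (_≈_)
  open Membership (E G) using (_∈_)

  Explained : Signature G → List (Edge G) → (Vertex → Sign) → Edge G → Set
  Explained σ D θ e = e ∈ D ⊎ σ ⟨$⟩ e ≡ θ (src e) * θ (tgt e)

  module _ (σ : Signature G) (θ : Vertex → Sign) where

    -- Allows checking a single orientation of each edge; reversal only swaps the two factors.
    Explained-resp-≈ : ∀ {D e f} → e ≈ f → Explained σ D θ e → Explained σ D θ f
    Explained-resp-≈ {e = e} {f} e≈f (inj₁ e∈D) = inj₁ (∈-resp-≈ (E G) {x = e} {f} e≈f e∈D)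
    Explained-resp-≈ {e = e} {f} e≈f@(inj₁ (refl , refl)) (inj₂ σe) =
      inj₂ (trans (sym (Func.cong σ {e} {f} e≈f)) σe)
    Explained-resp-≈ {e = e} {f} e≈f@(inj₂ (refl , refl)) (inj₂ σe) =
      inj₂ (trans (sym (Func.cong σ {e} {f} e≈f)) (trans σe (*-comm (θ _) (θ _))))

    explained⇒balanced : ∀ {D} → (∀ e → Explained σ D θ e) → Balanced (restrict σ D)
    explained⇒balanced {D} explained = potential⇒balanced (restrict σ D) θ λ
      (edge (a , a∉D)) → [ (λ a∈D → contradiction a∈D a∉D) , id ]′ (explained (edge a))

    -- A packing and a balancing set of the same size certify each other's optimality. `D` may
    -- repeat edges, so it is deduplicated first.
    min-max : ∀ {D k} → NegativeTrianglePackingOfSize G σ k → length D ≤ k →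
      (∀ e → Explained σ D θ e) →
      IsFrustrationIndex G σ k × IsNegativeTrianglePackingNumber G σ k
    min-max {D} {k} packing D≤k explained =
      (balancing , weak-duality σ packing) , packing , λ packing′ → weak-duality σ packing′ balancing
      where
      D′ = deduplicate (_≈?_ {G}) D

      balancing′ : BalancingSetOfSize G σ (length D′)
      balancing′ = D′ , deduplicate-! E-decSetoid D , refl ,
        explained⇒balanced (λ e → Sum.map₁
          (∈-deduplicate⁺ (E G) (_≈?_ {G})
            (λ {f} {g} {h} → respʳ-flip (E G) {f} {g} {h}) {z = e}) (explained e))

      balancing : BalancingSetOfSize G σ k
      balancing = subst (BalancingSetOfSize G σ)
        -- Deduplication cannot lengthen `D`, and the packing forces at least `k` edges, so the size
        -- is exactly `k`.
        (ℕ.≤-antisym (ℕ.≤-trans (length-deduplicate (_≈?_ {G}) D) D≤k)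
                     (weak-duality σ packing balancing′))
        balancing′

-- The greedy scan on a sequence of triangle signs

Satisfied : ∀ {m} → (Fin m → Sign) → (Fin (suc m) → Sign) → Fin (suc m) ⊎ Fin m → Set
Satisfied t x (inj₁ j) = x j ≡ +
Satisfied t x (inj₂ i) = x (inject₁ i) * x (suc i) ≡ t i

-- The problem for triangles of signs t, with inj₁ j the j-th spoke and inj₂ i the
-- rim edge of triangle i. Here x is relative to the switching that makes all
-- spokes positive, so that tᵢ becomes the sign of the i-th rim edge.
record Solution {m} (t : Fin m → Sign) : Set where
  open Propositional using (_∈_)
  field
    x         : Fin (suc m) → Sign
    -- The boundary value lets a solution for later triangles be glued on: the rim edge entering it
    -- has product equal to its left value.
    x₀≡+      : x zero ≡ +
    triangles : List (Fin m)
    negative  : All (λ i → t i ≡ -) triangles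
    -- Indices differ by at least two, since triangles `i` and `i + 1` share a spoke.
    spaced    : AllPairs (λ i j → suc (toℕ i) < toℕ j) triangles
    deleted   : List (Fin (suc m) ⊎ Fin m)
    size      : length deleted ≡ length triangles
    covered   : ∀ z → z ∈ deleted ⊎ Satisfied t x z

open Solution

shift : ∀ {m} → Fin (suc m) ⊎ Fin m → Fin (suc (suc m)) ⊎ Fin (suc m)
shift = Sum.map suc suc

skip-positive : ∀ {m} {t : Fin (suc m) → Sign} → t zero ≡ + → Solution (t ∘′ suc) → Solution t
skip-positive {t = t} t₀≡+ S = record
  { x         = + ◂ x S
  ; x₀≡+      = refl
  ; triangles = map suc (triangles S)
  ; negative  = All.map⁺ (negative S)
  ; spaced    = AllPairs.map⁺ (AllPairs.map s≤s (spaced S))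
  ; deleted   = map shift (deleted S)
  ; size      = trans (length-map shift (deleted S))
                  (trans (size S) (sym (length-map suc (triangles S))))
  ; covered   = λ where
      (inj₁ zero)    → inj₂ refl
      (inj₂ zero)    → inj₂ (trans (x₀≡+ S) (sym t₀≡+))
      (inj₁ (suc j)) → Sum.map₁ (∈-map⁺ shift) (covered S (inj₁ j))
      (inj₂ (suc i)) → Sum.map₁ (∈-map⁺ shift) (covered S (inj₂ i))
  }

pack-last : {t : Fin 1 → Sign} → t zero ≡ - → Solution t
pack-last t₀≡- = record
  { x         = λ _ → +
  ; x₀≡+      = refl
  ; triangles = [ zero ]
  ; negative  = t₀≡- ∷ []
  ; spaced    = [] ∷ []
  ; deleted   = [ inj₂ zero ]
  ; size      = refl
  ; covered   = λ where
      (inj₁ _)    → inj₂ refl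
      (inj₂ zero) → inj₁ (here refl)
  }

-- Giving vertex 1 the value `t (suc zero)` satisfies rim edge 1, because vertex 2 has value `+`.
-- Spoke 1 wants this value to be `+` and rim edge 0 wants it to be `-`, so exactly one of them
-- fails and is deleted.
pack-and-skip : ∀ {m} {t : Fin (suc (suc m)) → Sign} → t zero ≡ - →
                Solution (t ∘′ suc ∘′ suc) → Solution t
pack-and-skip {m} {t} t₀≡- S = record
  { x         = y
  ; x₀≡+      = refl
  ; triangles = zero ∷ map (suc ∘′ suc) (triangles S)
  ; negative  = t₀≡- ∷ All.map⁺ (negative S)
  ; spaced    = All.map⁺ (All.universal (λ _ → s≤s (s≤s z≤n)) (triangles S))
              ∷ AllPairs.map⁺ (AllPairs.map (s≤s ∘ s≤s) (spaced S))
  ; deleted   = removed ∷ map (shift ∘′ shift) (deleted S)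
  ; size      = cong suc (trans (length-map (shift ∘′ shift) (deleted S))
                  (trans (size S) (sym (length-map (suc ∘′ suc) (triangles S)))))
  ; covered   = λ where
      (inj₁ zero)          → inj₂ refl
      (inj₁ (suc zero))    → Sum.map₁ here spoke₁
      (inj₂ zero)          → Sum.map₁ here rim₀
      (inj₂ (suc zero))    → inj₂ (trans (cong (t (suc zero) *_) (x₀≡+ S)) (*-identityʳ _))
      (inj₁ (suc (suc j))) → Sum.map₁ (there ∘ ∈-map⁺ (shift ∘′ shift)) (covered S (inj₁ j))
      (inj₂ (suc (suc i))) → Sum.map₁ (there ∘ ∈-map⁺ (shift ∘′ shift)) (covered S (inj₂ i))
  }
  where
  y : Fin (suc (suc (suc m))) → Sign
  y = + ◂ (t (suc zero) ◂ x S)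

  -- A function of the sign, so that matching on `t (suc zero)` also evaluates `removed`.
  removalFor : Sign → Fin (suc (suc (suc m))) ⊎ Fin (suc (suc m))
  removalFor + = inj₂ zero
  removalFor - = inj₁ (suc zero)

  removed = removalFor (t (suc zero))

  spoke₁ : inj₁ (suc zero) ≡ removed ⊎ t (suc zero) ≡ +
  spoke₁ with t (suc zero)
  ... | + = inj₂ refl
  ... | - = inj₁ refl

  rim₀ : inj₂ zero ≡ removed ⊎ t (suc zero) ≡ t zero
  rim₀ with t (suc zero)
  ... | + = inj₁ refl
  ... | - = inj₂ (sym t₀≡-)

greedy : ∀ m (t : Fin m → Sign) → Solution t
greedy zero t = record
  { x = λ _ → + ; x₀≡+ = refl ; triangles = [] ; negative = [] ; spaced = []
  ; deleted = [] ; size = refl ; covered = λ { (inj₁ _) → inj₂ refl } }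
greedy (suc m) t with t zero in t₀
greedy (suc m)       t | + = skip-positive t₀ (greedy m (t ∘′ suc))
greedy (suc zero)    t | - = pack-last t₀
greedy (suc (suc m)) t | - = pack-and-skip t₀ (greedy m (t ∘′ suc ∘′ suc))

-- Edges and triangles of the fan

module Fan (m : ℕ) where
  open Graph (F (suc m)) using (Vertex)
  open Setoid (E (F (suc m))) using (_≈_)
  open Membership (E (F (suc m))) using (_∈_)
  open Edge

  hub : Vertex
  hub = inj₁ zero

  spoke : Fin (suc m) → Edge (F (suc m))
  spoke j = edge {src = hub} {inj₂ j} tt

  rim : Fin m → Edge (F (suc m))
  rim i = edge {src = inj₂ (inject₁ i)} {inj₂ (suc i)} (inj₁ (cong suc (toℕ-inject₁ i)))

  fanEdge : Fin (suc m) ⊎ Fin m → Edge (F (suc m))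
  fanEdge = [ spoke , rim ]′

  consecutive : (a b : Fin (suc m)) → suc (toℕ a) ≡ toℕ b →
                ∃[ i ] inject₁ i ≡ a × suc i ≡ b
  consecutive a (suc i) a+1≡b =
    i , toℕ-injective (trans (toℕ-inject₁ i) (sym (ℕ.suc-injective a+1≡b))) , refl

  -- Reduces statements about all edges to the spokes directed away from the hub and the rim edges
  -- directed to the right.
  fanEdge-surjective : ∀ e → ∃[ z ] fanEdge z ≈ e
  fanEdge-surjective (edge {inj₁ zero} {inj₁ zero} a) = contradiction refl a
  fanEdge-surjective (edge {inj₁ zero} {inj₂ j} _) = inj₁ j , inj₁ (refl , refl)
  fanEdge-surjective (edge {inj₂ j} {inj₁ zero} _) = inj₁ j , inj₂ (refl , refl)
  fanEdge-surjective (edge {inj₂ a} {inj₂ b} (inj₁ p)) with i , refl , refl ← consecutive a b p =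
    inj₂ i , inj₁ (refl , refl)
  fanEdge-surjective (edge {inj₂ a} {inj₂ b} (inj₂ p)) with i , refl , refl ← consecutive b a p =
    inj₂ i , inj₂ (refl , refl)

  height : Vertex → ℕ
  height (inj₁ _) = 0
  height (inj₂ j) = toℕ j

  triangle : Fin m → Cycle (F (suc m))
  triangle i = record
    { start    = hub
    ; end      = inj₂ (suc i)
    ; path     = adjacent (spoke (inject₁ i)) ◅ adjacent (rim i) ◅ ε
    ; closing  = tt
    ; distinct = ((λ ()) ∷ (λ ()) ∷ [])
               ∷ ((λ eq → ℕ.1+n≢n (trans (cong height (sym eq)) (toℕ-inject₁ i))) ∷ [])
               ∷ [] ∷ []
    ; long     = s≤s (s≤s (s≤s z≤n))
    }

  -- Spoke j has rank j and rim edge i has rank i + 1, so that the edges of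
  -- triangle i have ranks i and i + 1 only.
  rank : Edge (F (suc m)) → ℕ
  rank e = height (src e) ⊔ height (tgt e)

  rank-cong : ∀ {e f} → e ≈ f → rank e ≡ rank f
  rank-cong         (inj₁ (refl , refl)) = refl
  rank-cong {e = e} (inj₂ (refl , refl)) = ℕ.⊔-comm (height (src e)) (height (tgt e))

  _RankedIn_ : Edge (F (suc m)) → Fin m → Set
  e RankedIn i = toℕ i ≤ rank e × rank e ≤ suc (toℕ i)

  triangle-ranks : ∀ i {e} → e ∈ Cycle.edges (triangle i) → e RankedIn i
  triangle-ranks i {e} = All.lookupₛ (E (F (suc m))) {P = _RankedIn i}
    (λ {e} {f} e≈f → subst (λ r → toℕ i ≤ r × r ≤ suc (toℕ i)) (rank-cong {e} {f} e≈f))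
    -- In cycle order: the closing spoke `i + 1`, then spoke `i`, then rim edge `i`.
    ( (ℕ.n≤1+n _ , ℕ.≤-refl)
    ∷ subst (λ r → toℕ i ≤ r × r ≤ suc (toℕ i)) (sym (toℕ-inject₁ i)) (ℕ.≤-refl , ℕ.n≤1+n _)
    ∷ subst (λ r → toℕ i ≤ r ⊔ suc (toℕ i) × r ⊔ suc (toℕ i) ≤ suc (toℕ i)) (sym (toℕ-inject₁ i))
        (ℕ.m≤m⊔n _ _ , ℕ.⊔-lub (ℕ.n≤1+n _) ℕ.≤-refl)
    ∷ []) {e}

  -- A common edge would have rank at least `j` and at most `i + 1`.
  spaced⇒disjoint : ∀ {i j} → suc (toℕ i) < toℕ j → EdgeDisjoint (triangle i) (triangle j)
  spaced⇒disjoint {i} {j} i+1<j {e} (e∈Tᵢ , e∈Tⱼ) = ℕ.<-irrefl refl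
    (ℕ.<-≤-trans i+1<j
      (ℕ.≤-trans (proj₁ (triangle-ranks j {e} e∈Tⱼ)) (proj₂ (triangle-ranks i {e} e∈Tᵢ))))

  -- Transferring the greedy solution to a signature of the fan

  module _ (σ : Signature (F (suc m))) where

    spokeSign : Fin (suc m) → Sign
    spokeSign j = σ ⟨$⟩ spoke j

    -- Needed because the closing edge of a triangle runs towards the hub, while `spoke` runs away
    -- from it.
    spokeSign-sym : ∀ j → spokeSign j ≡ σ ⟨$⟩ edge {src = inj₂ j} {hub} tt
    spokeSign-sym j = Func.cong σ {spoke j} {edge {src = inj₂ j} {hub} tt} (inj₂ (refl , refl))

    -- The factor `spokeSign j` undoes the switching that makes all spokes positive.
    potential : (Fin (suc m) → Sign) → Vertex → Sign
    potential x (inj₁ _) = +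
    potential x (inj₂ j) = x j * spokeSign j

    -- The first factor is a triangle's `cycleSign` as it unfolds, with spokes `a`, `b` and rim edge
    -- `r`; the trailing `+` is the base of the fold.
    cancel-spokes : ∀ a b r → (b * (a * (r * +))) * (a * b) ≡ r
    cancel-spokes + + + = refl
    cancel-spokes + + - = refl
    cancel-spokes + - + = refl
    cancel-spokes + - - = refl
    cancel-spokes - + + = refl
    cancel-spokes - + - = refl
    cancel-spokes - - + = refl
    cancel-spokes - - - = refl

    satisfied⇒potential : ∀ {x} z → Satisfied (λ i → cycleSign σ (triangle i)) x z →
      σ ⟨$⟩ fanEdge z ≡ potential x (src (fanEdge z)) * potential x (tgt (fanEdge z))
    satisfied⇒potential (inj₁ j) xⱼ≡+ = cong (_* spokeSign j) (sym xⱼ≡+)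
    satisfied⇒potential {x} (inj₂ i) xx≡t = begin
      σ ⟨$⟩ rim i                         ≡⟨ cancel-spokes a b _ ⟨
      (b * (a * ((σ ⟨$⟩ rim i) * +))) * (a * b)
        ≡⟨ cong (λ s → (s * (a * ((σ ⟨$⟩ rim i) * +))) * (a * b)) (spokeSign-sym (suc i)) ⟩
      cycleSign σ (triangle i) * (a * b)  ≡⟨ cong (_* (a * b)) xx≡t ⟨
      (x (inject₁ i) * x (suc i)) * (a * b)
        ≡⟨ interchange (x (inject₁ i)) (x (suc i)) a b ⟩
      (x (inject₁ i) * a) * (x (suc i) * b) ∎
      where
      open ≡-Reasoning
      a = spokeSign (inject₁ i)
      b = spokeSign (suc i)

    fan-min-max : ∃[ k ] IsFrustrationIndex (F (suc m)) σ k
                       × IsNegativeTrianglePackingNumber (F (suc m)) σ k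
    fan-min-max = length (triangles S) ,
      min-max σ (potential (x S))
        ( map triangle (triangles S)
        , All.map⁺ (All.map (refl ,_) (negative S))
        , AllPairs.map⁺ (AllPairs.map spaced⇒disjoint (spaced S))
        , length-map triangle (triangles S))
        (ℕ.≤-reflexive (trans (length-map fanEdge (deleted S)) (size S)))
        explained
      where
      S = greedy m (λ i → cycleSign σ (triangle i))

      explained : ∀ e → Explained σ (map fanEdge (deleted S)) (potential (x S)) e
      explained e with z , z≈e ← fanEdge-surjective e =
        Explained-resp-≈ σ (potential (x S)) {e = fanEdge z} {e} z≈e
          -- Propositional membership is weakened to membership up to orientation.
          (Sum.map (λ z∈ → Any.map (λ { refl → inj₁ (refl , refl) }) (∈-map⁺ fanEdge z∈))
                   (satisfied⇒potential z) (covered S z))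

theorem18 : ∀ n → n ≥ 1 → (σ : Signature (F n)) →
    ∃[ l ] ∃[ p ] IsFrustrationIndex (F n) σ l
    × IsNegativeTrianglePackingNumber (F n) σ p
    × l ≡ p
theorem18 (suc m) _ σ with k , frustration , packing ← Fan.fan-min-max m σ =
  k , k , frustration , packing , refl
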